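{- Let $k \geq -2$ be a truncation level and let $f : A \to B$ be a map of types. The following are equivalent: (i) $f$ is a $k$-epimorphism; (ii) the codiagonal $\nabla_f : B +_A B \to B$ is a $k$-equivalence; (iii) the codiagonal $\nabla_f$ is $k$-connected; (iv) $f$ is $k$-acyclic; (v) $f$ is a dependent $k$-epimorphism.
   Context: We work in homotopy type theory (HoTT) in the style of the HoTT Book: dependent type theory with univalent universes (hence function extensionality) and higher inductive types such as pushouts and truncations; no classical axioms are assumed. A map is an embedding if its action on identity types is an equivalence. $\|A\|_k$ denotes the $k$-truncation; a type $A$ is $k$-connected if $\|A\|_k$ is contractible, and a map is $k$-connected if all its fibers are. A map $f : A \to B$ is a $k$-epimorphism if for every $k$-type $X$ the precomposition map $f^* : (B \to X) \to (A \to X)$ is an embedding. It is a dependent $k$-epimorphism if for every family $P$ of $k$-types over $B$ the precomposition map $f^* : \prod_{b:B} P(b) \to \prod_{a:A} P(f(a))$ is an embedding. The suspension $\Sigma A$ is the pushout of $\mathbf{1} \leftarrow A \to \mathbf{1}$. A type is $k$-acyclic if its suspension is $k$-connected; a map is $k$-acyclic if all its fibers are. A map is a $k$-equivalence if the induced map on $k$-truncations is an equivalence. The codiagonal $\nabla_f$ of $f : A \to B$ is the map $B +_A B \to B$ out of the pushout of $B \xleftarrow{f} A \xrightarrow{f} B$ induced by $\mathrm{id}_B$ on both copies of $B$. -}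

{-# OPTIONS --without-K #-}

-- Homotopy type theory is internalised as follows.  The background is Agda
-- without K, with the inductive identity type _≡_; univalence and the higher
-- inductive types, which Agda without Cubical does not provide, are the fields
-- of the record HoTT.  It is essential that K is off: univalence contradicts K.

module Defs where

open import Agda.Primitive using (Setω)
open import Data.Product using (Σ; _,_)
open import Data.Unit using (⊤; tt)
open import Function using (id; const)
open import Level using (Level; _⊔_) renaming (suc to lsuc)
open import Relation.Binary.PropositionalEquality
  using (_≡_; refl; trans; cong; subst; dcong)

private
  variable
    a b c ℓ : Level

isContr : Set a → Set a
isContr A = Σ A λ x → ∀ y → x ≡ y

fiber : {A : Set a} {B : Set b} → (A → B) → B → Set (a ⊔ b)
fiber {A = A} f y = Σ A λ x → f x ≡ y

isEquiv : {A : Set a} {B : Set b} → (A → B) → Set (a ⊔ b)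
isEquiv f = ∀ y → isContr (fiber f y)

_≃_ : Set a → Set b → Set (a ⊔ b)
A ≃ B = Σ (A → B) isEquiv

isEmbedding : {A : Set a} {B : Set b} → (A → B) → Set (a ⊔ b)
isEmbedding f = ∀ x y → isEquiv (cong f {x} {y})

id-isEquiv : (A : Set a) → isEquiv (id {A = A})
id-isEquiv A y = (y , refl) , λ { (_ , refl) → refl }

idToEquiv : {A B : Set ℓ} → A ≡ B → A ≃ B
idToEquiv {A = A} refl = id , id-isEquiv A

Univalence : (ℓ : Level) → Set (lsuc ℓ)
Univalence ℓ = (A B : Set ℓ) → isEquiv (idToEquiv {A = A} {B = B})

data TruncLevel : Set where
  ⟨-2⟩ : TruncLevel
  suc  : TruncLevel → TruncLevel

isType : TruncLevel → Set a → Set a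
isType ⟨-2⟩    A = isContr A
isType (suc k) A = (x y : A) → isType k (x ≡ y)

-- The k-types tested against range over the universe in which A and B live;
-- with the cumulative universes of the HoTT Book, A and B always share one.

isEpi : TruncLevel → {A B : Set ℓ} → (A → B) → Set (lsuc ℓ)
isEpi {ℓ} k {A} {B} f =
  (X : Set ℓ) → isType k X → isEmbedding λ (g : B → X) (x : A) → g (f x)

isDepEpi : TruncLevel → {A B : Set ℓ} → (A → B) → Set (lsuc ℓ)
isDepEpi {ℓ} k {A} {B} f =
  (P : B → Set ℓ) → (∀ y → isType k (P y)) →
  isEmbedding λ (s : (y : B) → P y) (x : A) → s (f x)

subst-const : {A : Set a} {B : Set b} {x y : A} (p : x ≡ y) {u : B} →
              subst (const B) p u ≡ u
subst-const refl = refl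

-- The computation rules of the higher inductive types are identifications, as a
-- field cannot be a judgmental equality.  Eliminators land in any universe.

record PushoutType {A : Set a} {B : Set b} {C : Set c}
                   (f : C → A) (g : C → B) : Setω where
  field
    Carrier : Set (a ⊔ b ⊔ c)
    inl     : A → Carrier
    inr     : B → Carrier
    glue    : (z : C) → inl (f z) ≡ inr (g z)

    ind :
      (P : Carrier → Set ℓ) (l : ∀ x → P (inl x)) (r : ∀ y → P (inr y)) →
      (∀ z → subst P (glue z) (l (f z)) ≡ r (g z)) →
      ∀ w → P w

    ind-inl :
      (P : Carrier → Set ℓ) (l : ∀ x → P (inl x)) (r : ∀ y → P (inr y))
      (q : ∀ z → subst P (glue z) (l (f z)) ≡ r (g z)) →
      ∀ x → ind P l r q (inl x) ≡ l x

    ind-inr :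
      (P : Carrier → Set ℓ) (l : ∀ x → P (inl x)) (r : ∀ y → P (inr y))
      (q : ∀ z → subst P (glue z) (l (f z)) ≡ r (g z)) →
      ∀ y → ind P l r q (inr y) ≡ r y

    -- The usual rule  dcong (ind P l r q) (glue z) ≡ q z,
    -- with both endpoints corrected by the two rules above.
    ind-glue :
      (P : Carrier → Set ℓ) (l : ∀ x → P (inl x)) (r : ∀ y → P (inr y))
      (q : ∀ z → subst P (glue z) (l (f z)) ≡ r (g z)) →
      ∀ z → trans (dcong (ind P l r q) (glue z)) (ind-inr P l r q (g z))
          ≡ trans (cong (subst P (glue z)) (ind-inl P l r q (f z))) (q z)

record TruncType (k : TruncLevel) (A : Set a) : Setω where
  field
    Carrier : Set a
    ∣_∣     : A → Carrier
    level   : isType k Carrier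

    ind :
      (P : Carrier → Set ℓ) → (∀ w → isType k (P w)) →
      (∀ x → P ∣ x ∣) → ∀ w → P w

    ind-∣∣ :
      (P : Carrier → Set ℓ) (t : ∀ w → isType k (P w)) (h : ∀ x → P ∣ x ∣) →
      ∀ x → ind P t h ∣ x ∣ ≡ h x

record HoTT : Setω where
  field
    univalence : ∀ ℓ → Univalence ℓ
    pushout    : {A : Set a} {B : Set b} {C : Set c}
                 (f : C → A) (g : C → B) → PushoutType f g
    trunc      : (k : TruncLevel) (A : Set a) → TruncType k A

  Pushout : {A : Set a} {B : Set b} {C : Set c} →
            (C → A) → (C → B) → Set (a ⊔ b ⊔ c)
  Pushout f g = PushoutType.Carrier (pushout f g)

  Trunc : TruncLevel → Set a → Set a
  Trunc k A = TruncType.Carrier (trunc k A)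

  Pushout-rec : {A : Set a} {B : Set b} {C : Set c} {f : C → A} {g : C → B}
                {D : Set ℓ} (l : A → D) (r : B → D) →
                (∀ z → l (f z) ≡ r (g z)) → Pushout f g → D
  Pushout-rec {f = f} {g = g} {D = D} l r q =
    ind (const D) l r λ z → trans (subst-const (glue z)) (q z)
    where open PushoutType (pushout f g)

  Trunc-map : (k : TruncLevel) {A : Set a} {B : Set b} →
              (A → B) → Trunc k A → Trunc k B
  Trunc-map k {A} {B} f =
    TruncType.ind (trunc k A) (const (Trunc k B)) (const TB.level)
                  λ x → TB.∣ f x ∣
    where module TB = TruncType (trunc k B)

  Suspension : Set a → Set a
  Suspension A = Pushout {A = ⊤} {B = ⊤} {C = A} (const tt) (const tt)

  codiagonal : {A : Set a} {B : Set b} (f : A → B) → Pushout f f → B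
  codiagonal f = Pushout-rec id id λ _ → refl

  isConnected : TruncLevel → Set a → Set a
  isConnected k A = isContr (Trunc k A)

  isConnectedMap : TruncLevel → {A : Set a} {B : Set b} → (A → B) → Set (a ⊔ b)
  isConnectedMap k f = ∀ y → isConnected k (fiber f y)

  isAcyclic : TruncLevel → Set a → Set a
  isAcyclic k A = isConnected k (Suspension A)

  isAcyclicMap : TruncLevel → {A : Set a} {B : Set b} → (A → B) → Set (a ⊔ b)
  isAcyclicMap k f = ∀ y → isAcyclic k (fiber f y)

  isTruncEquiv : TruncLevel → {A : Set a} {B : Set b} → (A → B) → Set (a ⊔ b)
  isTruncEquiv k f = isEquiv (Trunc-map k f)

{-# OPTIONS --without-K #-}
module Submission where

open import Defs
open import Data.Product using (_×_; Σ; _,_; proj₁; proj₂)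
open import Data.Unit using (⊤; tt)
open import Function using (id; const; _∘_)
open import Function.Bundles using (_⇔_; mk⇔)
open import Level using (Level) renaming (suc to lsuc)
open import Relation.Binary.PropositionalEquality
  using (_≡_; refl; sym; trans; cong; cong₂; subst; dcong; cong-app;
         module ≡-Reasoning)
open import Relation.Binary.PropositionalEquality.Properties
  using (trans-reflʳ; trans-symˡ; trans-cong; sym-cong; cong-∘)

-- Let E be the pushout of f along itself and ∇ : E → B the codiagonal.
-- If f is a k-epimorphism, the two inclusions of B become equal in the
-- k-truncation of E, compatibly with the glue, so |w| = |inl (∇ w)| for all w
-- and ∇ is a k-equivalence.  A k-equivalence r with a section s is k-connected:
-- "|w| = |s (r w)| in the truncated fiber" is a family of (k-1)-types over w,
-- and since the universe of (k-1)-types is a k-type (univalence), it descends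
-- to the truncation of E, where w and s (r w) are identified.
-- The remaining steps go through the following property of a type F: every
-- function F → x ≡ y into an identity type of a k-type is constant at some
-- path.  The fiber of ∇ over b carries a family of paths from inl b to inr b
-- indexed by the fiber of f, so this property holds of the fibers of f when ∇
-- is k-connected; it says of F both that its suspension is k-connected and,
-- applied to all the fibers of f, that f is a dependent k-epimorphism.

private
  variable
    a b ℓ ℓ' : Level

-- Contractibility, retracts and equivalences

contr-path : {A : Set a} → isContr A → (x y : A) → x ≡ y
contr-path (_ , c) x y = trans (sym (c x)) (c y)

contr-path-unique : {A : Set a} (c : isContr A) {x y : A} (p : x ≡ y) →
                    contr-path c x y ≡ p
contr-path-unique (_ , c) {x} refl = trans-symˡ (c x)

contr-≡ : {A : Set a} → isContr A → (x y : A) → isContr (x ≡ y)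
contr-≡ c x y = contr-path c x y , contr-path-unique c

retract-isContr : {A : Set a} {B : Set b} (r : A → B) (s : B → A) →
                  (∀ y → r (s y) ≡ y) → isContr A → isContr B
retract-isContr r s ε (x , c) = r x , λ y → trans (cong r (c (s y))) (ε y)

singleton-isContr : {A : Set a} (x : A) → isContr (Σ A λ y → y ≡ x)
singleton-isContr x = (x , refl) , λ { (_ , refl) → refl }

singleton-isContr′ : {A : Set a} (x : A) → isContr (Σ A λ y → x ≡ y)
singleton-isContr′ x = (x , refl) , λ { (_ , refl) → refl }

fiber-≡ : {A : Set a} {B : Set b} (f : A → B) {y : B} {x x' : A}
          {p : f x ≡ y} {p' : f x' ≡ y} (q : x ≡ x') →
          p ≡ trans (cong f q) p' → _≡_ {A = fiber f y} (x , p) (x' , p')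
fiber-≡ f refl refl = refl

trans-sym-cancelˡ : {A : Set a} {x y z : A} (p : x ≡ y) (q : x ≡ z) →
                    trans p (trans (sym p) q) ≡ q
trans-sym-cancelˡ refl _ = refl

sym-trans-cancelˡ : {A : Set a} {x y z : A} (p : x ≡ y) (q : y ≡ z) →
                    trans (sym p) (trans p q) ≡ q
sym-trans-cancelˡ refl _ = refl

-- The fiber over `y` is a retract of the pairs of `y'` and `f (g y') ≡ y`, and these are a retract
-- of the singleton at `y`; no coherence between `η` and `ε` enters.
inverse-isEquiv : {A : Set a} {B : Set b} (f : A → B) (g : B → A) →
                  (∀ x → g (f x) ≡ x) → (∀ y → f (g y) ≡ y) → isEquiv f
inverse-isEquiv f g η ε y =
  retract-isContr
    (λ (y' , p) → g y' , p)
    (λ (x , p) → f x , trans (cong f (η x)) p)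
    (λ (x , p) → fiber-≡ f (η x) refl)
    (retract-isContr
      (λ (y' , p) → y' , trans (ε y') p)
      (λ (y' , p) → y' , trans (sym (ε y')) p)
      (λ (y' , p) → cong (y' ,_) (trans-sym-cancelˡ (ε y') p))
      (singleton-isContr y))

equiv-inv : {A : Set a} {B : Set b} {f : A → B} → isEquiv f → B → A
equiv-inv e y = proj₁ (proj₁ (e y))

equiv-inv-left : {A : Set a} {B : Set b} {f : A → B} (e : isEquiv f) →
                 ∀ x → equiv-inv e (f x) ≡ x
equiv-inv-left {f = f} e x = cong proj₁ (proj₂ (e (f x)) (x , refl))

equiv-injective : {A : Set a} {B : Set b} {f : A → B} → isEquiv f →
                  ∀ {x y} → f x ≡ f y → x ≡ y
equiv-injective e {x} {y} p =
  trans (sym (equiv-inv-left e x)) (trans (cong (equiv-inv e) p) (equiv-inv-left e y))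

-- A section σ of the action on paths need not preserve refl; composing with
-- the inverse of σ refl repairs this and makes σ a two-sided inverse.
isEmbedding-from-section :
  {A : Set a} {B : Set b} (f : A → B) →
  (∀ x y (q : f x ≡ f y) → fiber (cong f {x} {y}) q) → isEmbedding f
isEmbedding-from-section f sec x y =
  inverse-isEquiv (cong f) (λ q → trans (sym (σ refl)) (σ q))
    (λ { refl → trans-symˡ (σ refl) })
    (λ q → begin
      cong f (trans (sym (σ refl)) (σ q))
        ≡⟨ sym (trans-cong (sym (σ refl))) ⟩
      trans (cong f (sym (σ refl))) (cong f (σ q))
        ≡⟨ cong₂ trans (sym (sym-cong (σ refl))) (proj₂ (sec x y q)) ⟩
      trans (sym (cong f (σ refl))) q
        ≡⟨ cong (λ p → trans (sym p) q) (proj₂ (sec x x refl)) ⟩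
      q ∎)
  where
  open ≡-Reasoning
  σ : ∀ {z} → f x ≡ f z → x ≡ z
  σ {z} q = proj₁ (sec x z q)

-- Truncation levels

retract-isType : ∀ n {A : Set a} {B : Set b} (r : A → B) (s : B → A) →
                 (∀ y → r (s y) ≡ y) → isType n A → isType n B
retract-isType ⟨-2⟩ = retract-isContr
retract-isType (suc n) r s ε t x y =
  retract-isType n
    (λ p → trans (sym (ε x)) (trans (cong r p) (ε y)))
    (cong s)
    (λ { refl → trans-symˡ (ε x) })
    (t (s x) (s y))

isType-suc : ∀ n {A : Set a} → isType n A → isType (suc n) A
isType-suc ⟨-2⟩    = contr-≡
isType-suc (suc n) t x y = isType-suc n (t x y)

contr-isType : ∀ n {A : Set a} → isContr A → isType n A
contr-isType ⟨-2⟩    c = c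
contr-isType (suc n) c = isType-suc n (contr-isType n c)

Σ-≡-isType : ∀ n {A : Set a} {P : A → Set b} {u v : Σ A P} →
             isType n (Σ (proj₁ u ≡ proj₁ v) λ p → subst P p (proj₂ u) ≡ proj₂ v) →
             isType n (u ≡ v)
Σ-≡-isType n {A} {P} = retract-isType n join split (λ { refl → refl })
  where
  join : ∀ {u v : Σ A P} →
         (Σ (proj₁ u ≡ proj₁ v) λ p → subst P p (proj₂ u) ≡ proj₂ v) → u ≡ v
  join (refl , refl) = refl
  split : ∀ {u v : Σ A P} → u ≡ v →
          Σ (proj₁ u ≡ proj₁ v) λ p → subst P p (proj₂ u) ≡ proj₂ v
  split refl = refl , refl

Σ-isType : ∀ n {A : Set a} {P : A → Set b} →
           isType n A → (∀ x → isType n (P x)) → isType n (Σ A P)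
Σ-isType ⟨-2⟩ {P = P} (x , c) t =
  (x , proj₁ (t x)) ,
  λ (y , u) → pair-≡ (c y) (contr-path (t y) _ u)
  where
  pair-≡ : ∀ {x y u v} (p : x ≡ y) → subst P p u ≡ v → _≡_ {A = Σ _ P} (x , u) (y , v)
  pair-≡ refl refl = refl
Σ-isType (suc n) tA tP u v =
  Σ-≡-isType n (Σ-isType n (tA _ _) λ _ → tP _ _ _)

module Homotopy (H : HoTT) where
  open HoTT H

  -- Function extensionality

  -- Univalence presents `e` as `idToEquiv` of a path, and path induction turns the postcomposition
  -- into the identity.
  ∘-isEquiv : (C : Set ℓ) {A B : Set ℓ} (e : A ≃ B) →
              isEquiv λ (g : C → A) → proj₁ e ∘ g
  ∘-isEquiv {ℓ} C {A} {B} e with univalence ℓ A B e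
  ... | (refl , refl) , _ = id-isEquiv (C → A)

  -- Voevodsky's argument: `proj₁ : Σ A P → A` is an equivalence, hence so is postcomposition with
  -- it, and the sections of `P` are a retract of the fiber of the latter over `id`.
  Π-isContr : {A : Set ℓ} {P : A → Set ℓ} → (∀ x → isContr (P x)) →
              isContr (∀ x → P x)
  Π-isContr {A = A} {P} c =
    retract-isContr
      (λ (g , p) x → subst P (cong-app p x) (proj₂ (g x)))
      (λ s → (λ x → x , s x) , refl)
      (λ _ → refl)
      (∘-isEquiv A (proj₁ , proj₁-isEquiv) id)
    where
    proj₁-isEquiv : isEquiv (proj₁ {B = P})
    proj₁-isEquiv =
      inverse-isEquiv proj₁ (λ x → x , proj₁ (c x))
        (λ (x , u) → cong (x ,_) (proj₂ (c x) u))
        (λ _ → refl)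

  module _ {A : Set ℓ} {P : A → Set ℓ} {f : ∀ x → P x} where

    -- A retract of a product of singletons. This is homotopy induction, from which `funext` and its
    -- two inverse laws are read off.
    homotopies-isContr : isContr (Σ (∀ x → P x) λ g → ∀ x → f x ≡ g x)
    homotopies-isContr =
      retract-isContr
        (λ u → (λ x → proj₁ (u x)) , (λ x → proj₂ (u x)))
        (λ (g , h) x → g x , h x)
        (λ _ → refl)
        (Π-isContr λ x → singleton-isContr′ (f x))

    funext : {g : ∀ x → P x} → (∀ x → f x ≡ g x) → f ≡ g
    funext {g} h = cong proj₁ (contr-path homotopies-isContr (f , λ _ → refl) (g , h))

    funext-cong-app : {g : ∀ x → P x} (p : f ≡ g) → funext (cong-app p) ≡ p
    funext-cong-app refl = cong (cong proj₁) (contr-path-unique homotopies-isContr refl)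

    cong-app-funext : {g : ∀ x → P x} (h : ∀ x → f x ≡ g x) →
                      ∀ x → cong-app (funext h) x ≡ h x
    cong-app-funext {g} h =
      along (contr-path homotopies-isContr (f , λ _ → refl) (g , h))
      where
      along : ∀ {u} (p : (f , λ _ → refl) ≡ u) →
              ∀ x → cong-app (cong proj₁ p) x ≡ proj₂ u x
      along refl _ = refl

  -- The universe of n-types

  Π-isType : ∀ n {A : Set ℓ} {P : A → Set ℓ} →
             (∀ x → isType n (P x)) → isType n (∀ x → P x)
  Π-isType ⟨-2⟩ = Π-isContr
  Π-isType (suc n) t f g =
    retract-isType n funext cong-app funext-cong-app (Π-isType n λ x → t x (f x) (g x))

  isContr-isType : ∀ n {A : Set ℓ} → isType n A → isType n (isContr A)
  isContr-isType n t = Σ-isType n t λ x → Π-isType n λ y → isType-suc n t x y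

  isType-isProp : ∀ n {A : Set ℓ} → isType (suc ⟨-2⟩) (isType n A)
  -- The first of the two points to be compared already makes `A`, and so `isContr A`, contractible.
  isType-isProp ⟨-2⟩ c = contr-≡ (isContr-isType ⟨-2⟩ c) c
  isType-isProp (suc n) =
    Π-isType (suc ⟨-2⟩) λ x → Π-isType (suc ⟨-2⟩) λ y → isType-isProp n

  ≃-isType : ∀ n {A B : Set ℓ} → isType n A → isType n B → isType n (A ≃ B)
  ≃-isType n tA tB =
    Σ-isType n (Π-isType n λ _ → tB) λ f → Π-isType n λ y →
      isContr-isType n (Σ-isType n tA λ x → isType-suc n tB (f x) y)

  -- A path of n-types is a path of the underlying types, which univalence makes a retract of
  -- `A ≃ B`, together with a path between proofs of a proposition.
  universe-isType : ∀ n → isType (suc n) (Σ (Set ℓ) (isType n))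
  universe-isType {ℓ} n (A , tA) (B , tB) =
    Σ-≡-isType n
      (Σ-isType n
        (retract-isType n (equiv-inv (univalence ℓ A B)) idToEquiv
          (equiv-inv-left (univalence ℓ A B)) (≃-isType n tA tB))
        λ _ → contr-isType n (isType-isProp n _ _))

  -- Truncations and pushouts

  module _ (k : TruncLevel) {A : Set a} where
    open TruncType (trunc k A)

    Trunc-rec : {X : Set b} → isType k X → (A → X) → Trunc k A → X
    Trunc-rec {X = X} t = ind (const X) (const t)

    Trunc-rec-∣∣ : {X : Set b} (t : isType k X) (g : A → X) →
                   ∀ x → Trunc-rec t g ∣ x ∣ ≡ g x
    Trunc-rec-∣∣ {X = X} t = ind-∣∣ (const X) (const t)

  ∣_∣[_] : {A : Set a} → A → ∀ k → Trunc k A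
  ∣_∣[_] {A = A} x k = TruncType.∣_∣ (trunc k A) x

  Trunc-level : ∀ k {A : Set a} → isType k (Trunc k A)
  Trunc-level k {A} = TruncType.level (trunc k A)

  Trunc-map-∣∣ : ∀ k {A : Set a} {B : Set b} (f : A → B) (x : A) →
                 Trunc-map k f ∣ x ∣[ k ] ≡ ∣ f x ∣[ k ]
  Trunc-map-∣∣ k f = Trunc-rec-∣∣ k (Trunc-level k) λ x → ∣ f x ∣[ k ]

  Trunc-ind-≡ : ∀ k {A : Set a} {X : Set b} → isType k X →
                (g h : Trunc k A → X) → (∀ x → g ∣ x ∣[ k ] ≡ h ∣ x ∣[ k ]) →
                ∀ u → g u ≡ h u
  Trunc-ind-≡ k {A} t g h =
    TruncType.ind (trunc k A) (λ u → g u ≡ h u) (λ u → isType-suc k t (g u) (h u))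

  -- As `X` is a k-type, `g` factors through the truncation of `E`. That truncation is contractible,
  -- so all `m z` become one path there. This path exists before any `z` is given.
  connected-path-const :
    ∀ k {E : Set a} {X : Set b} {F : Set ℓ} → isConnected k E → isType k X →
    (g : E → X) {u v : E} (m : F → u ≡ v) →
    Σ (g u ≡ g v) λ p → ∀ z → p ≡ cong g (m z)
  connected-path-const k {E} c t g {u} {v} m =
    along (contr-path c ∣ u ∣[ k ] ∣ v ∣[ k ]) ,
    λ z → trans (cong along (contr-path-unique c (cong ∣_∣[ k ] (m z)))) (along-cong (m z))
    where
    ḡ = Trunc-rec k t g
    β = Trunc-rec-∣∣ k t g
    along : ∀ {u v : E} → ∣ u ∣[ k ] ≡ ∣ v ∣[ k ] → g u ≡ g v
    along {u} {v} p = trans (sym (β u)) (trans (cong ḡ p) (β v))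
    along-cong : ∀ {u v} (p : u ≡ v) → along (cong ∣_∣[ k ] p) ≡ cong g p
    along-cong {u} refl = trans-symˡ (β u)

  module _ {A : Set a} {B : Set b} {C : Set ℓ} (f : C → A) (g : C → B) where
    open PushoutType (pushout f g)

    Pushout-ind-≡ : {X : Set ℓ'} (h h' : Pushout f g → X)
      (l : ∀ x → h (inl x) ≡ h' (inl x)) (r : ∀ y → h (inr y) ≡ h' (inr y)) →
      (∀ z → trans (l (f z)) (cong h' (glue z)) ≡ trans (cong h (glue z)) (r (g z))) →
      ∀ w → h w ≡ h' w
    Pushout-ind-≡ h h' l r q =
      ind (λ w → h w ≡ h' w) l r λ z → square (glue z) (q z)
      where
      square : ∀ {w w'} (p : w ≡ w') {s : h w ≡ h' w} {t : h w' ≡ h' w'} →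
               trans s (cong h' p) ≡ trans (cong h p) t →
               subst (λ w → h w ≡ h' w) p s ≡ t
      square refl {s} e = trans (sym (trans-reflʳ s)) e

    module _ {D : Set ℓ'} (l : A → D) (r : B → D) (q : ∀ z → l (f z) ≡ r (g z)) where

      private
        q' : ∀ z → subst (const D) (glue z) (l (f z)) ≡ r (g z)
        q' z = trans (subst-const (glue z)) (q z)

      Pushout-rec-inl : ∀ x → Pushout-rec l r q (inl x) ≡ l x
      Pushout-rec-inl = ind-inl (const D) l r q'

      Pushout-rec-inr : ∀ y → Pushout-rec l r q (inr y) ≡ r y
      Pushout-rec-inr = ind-inr (const D) l r q'

      -- Removes the transport in the constant family from `ind-glue`; path induction on a general
      -- `p` absorbs `subst-const`.
      Pushout-rec-glue :
        ∀ z → trans (cong (Pushout-rec l r q) (glue z)) (Pushout-rec-inr (g z))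
            ≡ trans (Pushout-rec-inl (f z)) (q z)
      Pushout-rec-glue z =
        nondependent (Pushout-rec l r q) (glue z)
            (Pushout-rec-inl (f z)) (Pushout-rec-inr (g z)) (q z) (ind-glue (const D) l r q' z)
        where
        nondependent : (h : Pushout f g → D) {w w' : Pushout f g} (p : w ≡ w')
          {x y : D} (i : h w ≡ x) (j : h w' ≡ y) (s : x ≡ y) →
          trans (dcong h p) j
            ≡ trans (cong (subst (const D) p) i) (trans (subst-const p) s) →
          trans (cong h p) j ≡ trans i s
        nondependent h refl refl j s e = e

  -- Rigidity of identity types and acyclicity

  -- A section, up to homotopy, of the map from `x ≡ y` to the constant functions `F → x ≡ y`. The
  -- path is chosen independently of any point of `F`.
  PathRigid : TruncLevel → Set ℓ → Set (lsuc ℓ)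
  PathRigid {ℓ} k F =
    {X : Set ℓ} → isType k X → {x y : X} (h : F → x ≡ y) →
    Σ (x ≡ y) λ p → ∀ z → p ≡ h z

  -- The function `h` is the glue datum of a map `g` from the suspension to `X`, and connectedness
  -- makes `cong g (glue z)` independent of `z`.
  acyclic→rigid : ∀ k {F : Set ℓ} → isAcyclic k F → PathRigid k F
  acyclic→rigid k {F} c t {x} {y} h =
    trans (sym βl) (trans (proj₁ path) βr) ,
    λ z → begin
      trans (sym βl) (trans (proj₁ path) βr)
        ≡⟨ cong (λ p → trans (sym βl) (trans p βr)) (proj₂ path z) ⟩
      trans (sym βl) (trans (cong g (glue z)) βr)
        ≡⟨ cong (trans (sym βl)) (Pushout-rec-glue _ _ _ _ h z) ⟩
      trans (sym βl) (trans βl (h z))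
        ≡⟨ sym-trans-cancelˡ βl (h z) ⟩
      h z ∎
    where
    open ≡-Reasoning
    open PushoutType (pushout {C = F} (const tt) (const tt))
    g  = Pushout-rec {f = const tt} {g = const tt} (const x) (const y) h
    βl = Pushout-rec-inl {C = F} (const tt) (const tt) (const x) (const y) h tt
    βr = Pushout-rec-inr {C = F} (const tt) (const tt) (const x) (const y) h tt
    path = connected-path-const k c t g glue

  -- Rigidity applied to the truncated meridians yields one path between the poles that equals each
  -- of them; this is the coherence for contracting onto `inl tt`.
  rigid→acyclic : ∀ k {F : Set ℓ} → PathRigid k F → isAcyclic k F
  rigid→acyclic k {F} R =
    ∣ inl tt ∣[ k ] ,
    Trunc-ind-≡ k (Trunc-level k) (const ∣ inl tt ∣[ k ]) id
      (Pushout-ind-≡ _ _ (const ∣ inl tt ∣[ k ]) ∣_∣[ k ]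
        (const refl) (const (proj₁ path))
        λ z → begin
          cong ∣_∣[ k ] (glue z)
            ≡⟨ sym (proj₂ path z) ⟩
          proj₁ path
            ≡⟨ cong (λ p → trans p (proj₁ path)) (sym (cong-const (glue z))) ⟩
          trans (cong (const ∣ inl tt ∣[ k ]) (glue z)) (proj₁ path) ∎)
    where
    open ≡-Reasoning
    open PushoutType (pushout {C = F} (const tt) (const tt))
    path = R (Trunc-level k) (λ z → cong ∣_∣[ k ] (glue z))
    cong-const : {A : Set a} {B : Set b} {x y : A} {u : B} (p : x ≡ y) →
                 cong (const u) p ≡ refl
    cong-const refl = refl

  -- A path `q` between restrictions along `f` is, over each `y`, a function from the fiber to
  -- `s y ≡ s' y`. Rigidity picks its value, and the point `(x , refl)` shows that `q` is recovered.
  rigid→depEpi : ∀ k {A B : Set ℓ} (f : A → B) →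
                 (∀ y → PathRigid k (fiber f y)) → isDepEpi k f
  rigid→depEpi k {A} {B} f R P t =
    isEmbedding-from-section _ λ s s' q →
      let path = λ y → R y (t y) λ (x , p) → transport s s' p (cong-app q x) in
      funext (λ y → proj₁ (path y)) ,
      (begin
        cong (λ s x → s (f x)) (funext λ y → proj₁ (path y))
          ≡⟨ sym (funext-cong-app _) ⟩
        funext (cong-app (cong (λ s x → s (f x)) (funext λ y → proj₁ (path y))))
          ≡⟨ cong funext (funext λ x → begin
               cong-app (cong (λ s x → s (f x)) (funext λ y → proj₁ (path y))) x
                 ≡⟨ cong-app-precomp (funext λ y → proj₁ (path y)) x ⟩
               cong-app (funext λ y → proj₁ (path y)) (f x)
                 ≡⟨ cong-app-funext _ (f x) ⟩
               proj₁ (path (f x))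
                 ≡⟨ proj₂ (path (f x)) (x , refl) ⟩
               cong-app q x ∎) ⟩
        funext (cong-app q)
          ≡⟨ funext-cong-app q ⟩
        q ∎)
    where
    open ≡-Reasoning
    transport : (s s' : ∀ y → P y) {y y' : B} → y ≡ y' → s y ≡ s' y → s y' ≡ s' y'
    transport s s' refl e = e
    cong-app-precomp : {s s' : ∀ y → P y} (p : s ≡ s') (x : A) →
      cong-app (cong (λ s x → s (f x)) p) x ≡ cong-app p (f x)
    cong-app-precomp refl _ = refl

  -- The codiagonal

  truncEquiv-with-section-connected :
    ∀ k {E B : Set ℓ} (r : E → B) (s : B → E) → (∀ y → r (s y) ≡ y) →
    isTruncEquiv k r → isConnectedMap k r
  -- A (-2)-truncation is always contractible. The other case uses `k = suc n`, so that `Q` takes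
  -- values in n-types.
  truncEquiv-with-section-connected ⟨-2⟩ _ _ _ _ _ = Trunc-level ⟨-2⟩
  truncEquiv-with-section-connected {ℓ} (suc n) {E} {B} r s β e y =
    ∣ s y , β y ∣[ k ] ,
    Trunc-ind-≡ k (Trunc-level k) (const ∣ s y , β y ∣[ k ]) id
      λ { (w , refl) → sym (identify w) }
    where
    k = suc n

    Q : E → Set ℓ
    Q w = _≡_ {A = Trunc k (fiber r (r w))} ∣ w , refl ∣[ k ] ∣ s (r w) , β (r w) ∣[ k ]

    Q-level : ∀ w → isType n (Q w)
    Q-level w = Trunc-level k _ _

    -- Since `w` and `s (r w)` are identified only in the truncation, `Q` must be extended there
    -- before it can be transported.
    Q̄ : Trunc k E → Σ (Set ℓ) (isType n)
    Q̄ = Trunc-rec k (universe-isType n) λ w → Q w , Q-level w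

    Q̄-∣∣ : ∀ w → proj₁ (Q̄ ∣ w ∣[ k ]) ≡ Q w
    Q̄-∣∣ w = cong proj₁ (Trunc-rec-∣∣ k (universe-isType n) (λ w → Q w , Q-level w) w)

    retract : ∀ w → ∣ s (r w) ∣[ k ] ≡ ∣ w ∣[ k ]
    retract w = equiv-injective e (begin
      Trunc-map k r ∣ s (r w) ∣[ k ] ≡⟨ Trunc-map-∣∣ k r (s (r w)) ⟩
      ∣ r (s (r w)) ∣[ k ]           ≡⟨ cong ∣_∣[ k ] (β (r w)) ⟩
      ∣ r w ∣[ k ]                   ≡⟨ sym (Trunc-map-∣∣ k r w) ⟩
      Trunc-map k r ∣ w ∣[ k ]       ∎)
      where open ≡-Reasoning

    -- Writing `p` as `β y` followed by a path `y ≡ y'` allows induction on the latter. The instance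
    -- with `p = refl` proves `Q` at the points `s (r w)`.
    section-point : ∀ y y' (p : r (s y) ≡ y') →
                    _≡_ {A = fiber r y'} (s y , p) (s y' , β y')
    section-point y y' p =
      trans (cong (s y ,_) (sym (trans-sym-cancelˡ (β y) p)))
            (along (trans (sym (β y)) p))
      where
      along : ∀ {y'} (d : y ≡ y') →
              _≡_ {A = fiber r y'} (s y , trans (β y) d) (s y' , β y')
      along refl = cong (s y ,_) (trans-reflʳ (β y))

    identify : ∀ w → Q w
    identify w =
      subst id
        (trans (sym (Q̄-∣∣ (s (r w)))) (trans (cong (proj₁ ∘ Q̄) (retract w)) (Q̄-∣∣ w)))
        (cong ∣_∣[ k ] (section-point (r w) (r (s (r w))) refl))

  module _ (k : TruncLevel) {A B : Set ℓ} (f : A → B) where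
    open PushoutType (pushout f f)

    private
      ∇ : Pushout f f → B
      ∇ = codiagonal f

      βl : ∀ y → ∇ (inl y) ≡ y
      βl = Pushout-rec-inl f f id id λ _ → refl

      βr : ∀ y → ∇ (inr y) ≡ y
      βr = Pushout-rec-inr f f id id λ _ → refl

      βglue : ∀ z → trans (cong ∇ (glue z)) (βr (f z)) ≡ βl (f z)
      βglue z = trans (Pushout-rec-glue f f id id (λ _ → refl) z) (trans-reflʳ _)

    epi→codiagonal-truncEquiv : isEpi k f → isTruncEquiv k ∇
    epi→codiagonal-truncEquiv epi =
      inverse-isEquiv (Trunc-map k ∇) (Trunc-map k inl)
        (Trunc-ind-≡ k (Trunc-level k) (Trunc-map k inl ∘ Trunc-map k ∇) id λ w → begin
          Trunc-map k inl (Trunc-map k ∇ ∣ w ∣[ k ])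
            ≡⟨ cong (Trunc-map k inl) (Trunc-map-∣∣ k ∇ w) ⟩
          Trunc-map k inl ∣ ∇ w ∣[ k ]  ≡⟨ Trunc-map-∣∣ k inl (∇ w) ⟩
          ∣ inl (∇ w) ∣[ k ]            ≡⟨ sym (retract w) ⟩
          ∣ w ∣[ k ]                    ∎)
        (Trunc-ind-≡ k (Trunc-level k) (Trunc-map k ∇ ∘ Trunc-map k inl) id λ y → begin
          Trunc-map k ∇ (Trunc-map k inl ∣ y ∣[ k ])
            ≡⟨ cong (Trunc-map k ∇) (Trunc-map-∣∣ k inl y) ⟩
          Trunc-map k ∇ ∣ inl y ∣[ k ]  ≡⟨ Trunc-map-∣∣ k ∇ (inl y) ⟩
          ∣ ∇ (inl y) ∣[ k ]            ≡⟨ cong ∣_∣[ k ] (βl y) ⟩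
          ∣ y ∣[ k ]                    ∎)
      where
      open ≡-Reasoning

      ∣inl∣ ∣inr∣ : B → Trunc k (Pushout f f)
      ∣inl∣ y = ∣ inl y ∣[ k ]
      ∣inr∣ y = ∣ inr y ∣[ k ]

      inl≡inr : fiber (cong (λ (g : B → Trunc k (Pushout f f)) (x : A) → g (f x))
                            {∣inl∣} {∣inr∣})
                      (funext λ z → cong ∣_∣[ k ] (glue z))
      -- Precomposed with `f`, the two inclusions agree through `glue`; the embedding lifts this
      -- path to one between the inclusions themselves.
      inl≡inr = proj₁ (epi _ (Trunc-level k) ∣inl∣ ∣inr∣ _)

      p : ∀ y → ∣inl∣ y ≡ ∣inr∣ y
      p = cong-app (proj₁ inl≡inr)

      p-glue : ∀ z → p (f z) ≡ cong ∣_∣[ k ] (glue z)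
      p-glue z = begin
        p (f z)
          ≡⟨ precomp (proj₁ inl≡inr) ⟩
        cong-app (cong (λ g x → g (f x)) (proj₁ inl≡inr)) z
          ≡⟨ cong (λ q → cong-app q z) (proj₂ inl≡inr) ⟩
        cong-app (funext λ z → cong ∣_∣[ k ] (glue z)) z
          ≡⟨ cong-app-funext _ z ⟩
        cong ∣_∣[ k ] (glue z) ∎
        where
        precomp : ∀ {g h : B → Trunc k (Pushout f f)} (q : g ≡ h) →
                  cong-app q (f z) ≡ cong-app (cong (λ g x → g (f x)) q) z
        precomp refl = refl

      retract : ∀ w → ∣ w ∣[ k ] ≡ ∣inl∣ (∇ w)
      retract =
        Pushout-ind-≡ f f ∣_∣[ k ] (∣inl∣ ∘ ∇)
          (λ y → cong ∣inl∣ (sym (βl y)))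
          -- On the second copy the path first crosses to the first copy by `p`; the square over
          -- `glue` then closes by `p-glue` and `βglue`.
          (λ y → trans (sym (p y)) (cong ∣inl∣ (sym (βr y))))
          λ z → begin
            trans (cong ∣inl∣ (sym (βl (f z)))) (cong (∣inl∣ ∘ ∇) (glue z))
              ≡⟨ cong (trans _) (cong-∘ (glue z)) ⟩
            trans (cong ∣inl∣ (sym (βl (f z)))) (cong ∣inl∣ (cong ∇ (glue z)))
              ≡⟨ trans-cong (sym (βl (f z))) ⟩
            cong ∣inl∣ (trans (sym (βl (f z))) (cong ∇ (glue z)))
              ≡⟨ cong (cong ∣inl∣) (triangle (cong ∇ (glue z)) (βr (f z)) (βglue z)) ⟩
            cong ∣inl∣ (sym (βr (f z)))
              ≡⟨ sym (trans-sym-cancelˡ (p (f z)) _) ⟩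
            trans (p (f z)) (trans (sym (p (f z))) (cong ∣inl∣ (sym (βr (f z)))))
              ≡⟨ cong (λ q → trans q (trans (sym (p (f z))) (cong ∣inl∣ (sym (βr (f z))))))
                    (p-glue z) ⟩
            trans (cong ∣_∣[ k ] (glue z))
                  (trans (sym (p (f z))) (cong ∣inl∣ (sym (βr (f z))))) ∎
        where
        triangle : {X : Set ℓ} {x y z : X} (p : x ≡ y) (q : y ≡ z) {r : x ≡ z} →
                   trans p q ≡ r → trans (sym r) p ≡ sym q
        triangle refl refl refl = refl

    codiagonal-truncEquiv→connected : isTruncEquiv k ∇ → isConnectedMap k ∇
    codiagonal-truncEquiv→connected = truncEquiv-with-section-connected k ∇ inl βl

    -- The fiber of `∇` over `y` is the suspension of that of `f`. It is used only through its
    -- poles, its meridians and the map `g` to `X` that sends the poles to `x` and `x'` and the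
    -- meridians to `h`.
    codiagonal-connected→rigid : isConnectedMap k ∇ → ∀ y → PathRigid k (fiber f y)
    codiagonal-connected→rigid c y {X} t {x} {x'} h =
      trans (sym γl) (trans (proj₁ path) γr) ,
      λ z → begin
        trans (sym γl) (trans (proj₁ path) γr)
          ≡⟨ cong (λ p → trans (sym γl) (trans p γr)) (proj₂ path z) ⟩
        trans (sym γl) (trans (cong (λ (w , p) → g w p) (meridian z)) γr)
          ≡⟨ cong (trans (sym γl)) (g-meridian z) ⟩
        trans (sym γl) (trans γl (h z))
          ≡⟨ sym-trans-cancelˡ γl (h z) ⟩
        h z ∎
      where
      open ≡-Reasoning

      -- Maps out of the fiber of `∇` are curried, so that pushout induction on `w` defines them.
      P : Pushout f f → Set ℓ
      P w = ∇ w ≡ y → X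

      subst-P : ∀ {w w'} (p : w ≡ w') → subst P p (const x) ≡ const x
      subst-P refl = refl

      -- As `∇ (inr (f z))` is `f z` only up to `βr`, the path `p` is corrected to give a point of
      -- the fiber of `f`.
      h' : ∀ z (p : ∇ (inr (f z)) ≡ y) → x ≡ x'
      h' z p = h (z , trans (sym (βr (f z))) p)

      q : ∀ z → subst P (glue z) (const x) ≡ const x'
      q z = trans (subst-P (glue z)) (funext (h' z))

      g : ∀ w → ∇ w ≡ y → X
      g = ind P (λ _ _ → x) (λ _ _ → x') q

      gl : ∀ y' → g (inl y') ≡ const x
      gl = ind-inl P (λ _ _ → x) (λ _ _ → x') q

      gr : ∀ y' → g (inr y') ≡ const x'
      gr = ind-inr P (λ _ _ → x) (λ _ _ → x') q

      γl = cong-app (gl y) (βl y)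
      γr = cong-app (gr y) (βr y)

      meridian : fiber f y →
                 _≡_ {A = fiber ∇ y} (inl y , βl y) (inr y , βr y)
      meridian (z , refl) = fiber-≡ ∇ (glue z) (sym (βglue z))

      path = connected-path-const k (c y) t (λ (w , p) → g w p) meridian

      -- The factor `cong id` is what `cong (subst P p)` becomes once `p` is `refl`.
      cong-app-trans : {Y : Set ℓ} {u v w : Y → X} (p : u ≡ v) (q : v ≡ w) (y : Y) →
                       cong-app (trans (cong id p) q) y
                         ≡ trans (cong-app p y) (cong-app q y)
      cong-app-trans refl _ _ = refl

      -- Turns the computation rule of the curried `g` over `glue z` into one for its uncurried form
      -- along a meridian; general endpoints permit induction on `p` and `d`.
      g-along : ∀ {w w'} (p : w ≡ w') (i : g w ≡ const x) (j : g w' ≡ const x')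
        (e : const x ≡ const x') {s : ∇ w ≡ y} {s' : ∇ w' ≡ y}
        (d : s ≡ trans (cong ∇ p) s') →
        trans (dcong g p) j ≡ trans (cong (subst P p) i) (trans (subst-P p) e) →
        trans (cong (λ (w , p) → g w p) (fiber-≡ ∇ p d)) (cong-app j s')
          ≡ trans (cong-app i s) (cong-app e s')
      g-along refl i j e {s' = s'} refl E =
        trans (cong (λ a → cong-app a s') E) (cong-app-trans i e s')

      g-meridian : ∀ z → trans (cong (λ (w , p) → g w p) (meridian z)) γr
                       ≡ trans γl (h z)
      g-meridian (z , refl) = begin
        trans (cong (λ (w , p) → g w p) (meridian (z , refl))) γr
          ≡⟨ g-along (glue z) (gl (f z)) (gr (f z)) (funext (h' z)) (sym (βglue z))
               (ind-glue P (λ _ _ → x) (λ _ _ → x') q z) ⟩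
        trans γl (cong-app (funext (h' z)) (βr (f z)))
          ≡⟨ cong (trans γl) (cong-app-funext (h' z) (βr (f z))) ⟩
        trans γl (h (z , trans (sym (βr (f z))) (βr (f z))))
          ≡⟨ cong (λ p → trans γl (h (z , p))) (trans-symˡ (βr (f z))) ⟩
        trans γl (h (z , refl)) ∎

    codiagonal-connected→acyclic : isConnectedMap k ∇ → isAcyclicMap k f
    codiagonal-connected→acyclic c y = rigid→acyclic k (codiagonal-connected→rigid c y)

    acyclic→depEpi : isAcyclicMap k f → isDepEpi k f
    acyclic→depEpi c = rigid→depEpi k f λ y → acyclic→rigid k (c y)

    depEpi→epi : isDepEpi k f → isEpi k f
    depEpi→epi d X t = d (const X) (const t)

theorem3p6 : (H : HoTT) → let open HoTT H in
    ∀ {ℓ} (k : TruncLevel) {A B : Set ℓ} (f : A → B) →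
    (isEpi k f ⇔ isTruncEquiv k (codiagonal f))
    × (isTruncEquiv k (codiagonal f) ⇔ isConnectedMap k (codiagonal f))
    × (isConnectedMap k (codiagonal f) ⇔ isAcyclicMap k f)
    × (isAcyclicMap k f ⇔ isDepEpi k f)
theorem3p6 H k f =
    -- The five implications form a cycle, so each converse is the composite of the other four.
    mk⇔ i→ii (v→i ∘ iv→v ∘ iii→iv ∘ ii→iii)
  , mk⇔ ii→iii (i→ii ∘ v→i ∘ iv→v ∘ iii→iv)
  , mk⇔ iii→iv (ii→iii ∘ i→ii ∘ v→i ∘ iv→v)
  , mk⇔ iv→v (iii→iv ∘ ii→iii ∘ i→ii ∘ v→i)
  where
  open Homotopy H
  i→ii   = epi→codiagonal-truncEquiv k f
  ii→iii = codiagonal-truncEquiv→connected k f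
  iii→iv = codiagonal-connected→acyclic k f
  iv→v   = acyclic→depEpi k f
  v→i    = depEpi→epi k f
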